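{- For any formula $A$ of the language of $\mathsf{ILL}_\bot$, one obtains the Gödel-Gentzen translation $A^{\rm G}$ from the outer Kolmogorov translation $A^{{\rm K}_o}$ by systematically applying the following formula reductions, starting from the whole formula and inductively applying them to the subformulas: $$\neg\neg(\neg\neg A\,\&\,\neg\neg B)\mapsto\neg\neg A\,\&\,\neg\neg B,\qquad \neg\neg(\neg\neg A\otimes\neg\neg B)\mapsto\neg\neg A\otimes\neg\neg B,$$ $$\neg\neg(\neg\neg A\multimap\neg\neg B)\mapsto\neg\neg A\multimap\neg\neg B,\qquad \neg\neg\forall x\,\neg\neg A\mapsto\forall x\,\neg\neg A,\qquad \neg\neg\,!\,\neg\neg A\mapsto\,!\,\neg\neg A.$$ Hence $(\cdot)^{\rm G}$ is a simplification from outside of $(\cdot)^{{\rm K}_o}$ (as translations from $\mathsf{CL}_{\rm b}$ to $\mathsf{IL}_\bot$). Moreover, the reductions above are reversible in $\mathsf{IL}_\bot$ (i.e. the two sides of each reduction are provably equivalent in $\mathsf{IL}_\bot$), so $A^{\rm G}$ and $A^{{\rm K}_o}$ are $\mathsf{IL}_\bot$-equivalent.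
   Context: Intuitionistic linear logic $\mathsf{ILL}$ (first order). Formulas are built from atomic formulas, including the constants $1,\top,0$, using $\otimes,\&,\oplus,\multimap$, $\forall x,\exists x$ and $!$. Sequents are $\Gamma\vdash A$ with $\Gamma$ a finite multiset of formulas and exactly one formula on the right. Axioms: $A\vdash A$; $\vdash 1$; $\Gamma\vdash\top$; $\Gamma,0\vdash C$. Rules (premises $\Rightarrow$ conclusion): (cut) $\Gamma\vdash A;\ \Delta,A\vdash C\Rightarrow\Gamma,\Delta\vdash C$; $\Gamma\vdash C\Rightarrow\Gamma,1\vdash C$; $\Gamma\vdash A;\ \Delta\vdash B\Rightarrow\Gamma,\Delta\vdash A\otimes B$; $\Gamma,A,B\vdash C\Rightarrow\Gamma,A\otimes B\vdash C$; $\Gamma,A\vdash B\Rightarrow\Gamma\vdash A\multimap B$; $\Gamma\vdash A;\ \Delta,B\vdash C\Rightarrow\Gamma,\Delta,A\multimap B\vdash C$; $\Gamma\vdash A;\ \Gamma\vdash B\Rightarrow\Gamma\vdash A\& B$; $\Gamma,A\vdash C\Rightarrow\Gamma,A\& B\vdash C$; $\Gamma,B\vdash C\Rightarrow\Gamma,A\& B\vdash C$; $\Gamma\vdash A\Rightarrow\Gamma\vdash A\oplus B$; $\Gamma\vdash B\Rightarrow\Gamma\vdash A\oplus B$; $\Gamma,A\vdash C;\ \Gamma,B\vdash C\Rightarrow\Gamma,A\oplus B\vdash C$; $\Gamma\vdash A\Rightarrow\Gamma\vdash\forall xA$; $\Gamma,A[t/x]\vdash C\Rightarrow\Gamma,\forall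 xA\vdash C$; $\Gamma\vdash A[t/x]\Rightarrow\Gamma\vdash\exists xA$; $\Gamma,A\vdash C\Rightarrow\Gamma,\exists xA\vdash C$ (usual eigenvariable conditions); $\Gamma,!A,!A\vdash C\Rightarrow\Gamma,!A\vdash C$; $\Gamma\vdash C\Rightarrow\Gamma,!A\vdash C$; $!\Gamma\vdash A\Rightarrow\,!\Gamma\vdash\,!A$; $\Gamma,A\vdash C\Rightarrow\Gamma,!A\vdash C$. $\mathsf{ILL}_\bot$ extends $\mathsf{ILL}$ by one more constant $\bot$ (also counted as atomic); its sequents have at most one formula on the right (so $C$ in the rules above may be absent), and it has the additional axiom $\bot\vdash$ and rule $\Gamma\vdash\ \Rightarrow\Gamma\vdash\bot$. $\neg A:=A\multimap\bot$. $\mathsf{PRO}$: $A\vdash\,!A$; $\mathsf{DNE}$: $\neg\neg A\vdash A$ (axiom schemas). $\mathsf{IL}_\bot:=\mathsf{ILL}_\bot+\mathsf{PRO}$; $\mathsf{CL}_{\rm b}:=\mathsf{ILL}_\bot+\mathsf{PRO}+\mathsf{DNE}$. Formulas $A,B$ are equivalent over $S$ if $S$ proves $(A\multimap B)\&(B\multimap A)$. Translations. Throughout $\square\in\{\otimes,\&,\oplus,\multimap\}$, $Q\in\{\forall x,\exists x,!\}$. Outer Kolmogorov: $P^{{\rm K}_o}:=\neg\neg P$ ($P$ atomic), $(A\,\square\,B)^{{\rm K}_o}:=\neg\neg(A^{{\rm K}_o}\,\square\,B^{{\rm K}_o})$, $(QA)^{{\rm K}_o}:=\neg\neg QA^{{\rm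 K}_o}$. Gödel-Gentzen: $P^{\rm G}:=\neg\neg P$ ($P$ atomic); $(A\,\square\,B)^{\rm G}:=A^{\rm G}\,\square\,B^{\rm G}$ for $\square\in\{\otimes,\&,\multimap\}$; $(A\oplus B)^{\rm G}:=\neg\neg(A^{\rm G}\oplus B^{\rm G})$; $(\forall xA)^{\rm G}:=\forall xA^{\rm G}$; $(\exists xA)^{\rm G}:=\neg\neg\exists xA^{\rm G}$; $(!A)^{\rm G}:=\,!A^{\rm G}$. General notions, for a formula construct $T$ (here $T(A)=\neg\neg A$). A $T$-based outer-transform is $\mathcal T_\square(A,B)=T'(A\,\square\,B)$, resp. $\mathcal T_Q(A)=T'(QA)$, with $T'\in\{T,\mathrm{Id}\}$. A modular outer $T$-translation is one given by outer-transforms via $P^{\rm Tr}:=T(P)$ ($P$ atomic), $(A\,\square\,B)^{\rm Tr}:=\mathcal T^{\rm Tr}_\square(A^{\rm Tr},B^{\rm Tr})$, $(QA)^{\rm Tr}:=\mathcal T^{\rm Tr}_Q(A^{\rm Tr})$. A transform is simpler than another one for the same connective, quantifier or modality if the latter uses $T$ in all places where the former does, but not conversely. A translation is sound from $S_1$ to $S_2$ if for all $A$: $\vdash_{S_1}A$ implies $\vdash_{S_2}A^{\rm Tr}$, and $A$, $A^{\rm Tr}$ are equivalent over $S_1$. Two sound translations from $S_1$ to $S_2$ are equivalent if $A^{\rm Tr}$ and $A^{{\rm Tr}'}$ are equivalent over $S_2$ for all $A$. For equivalent translations, ${\rm Tr}'$ is a simplification of ${\rm Tr}$ if each transform of ${\rm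 Tr}'$ is identical to or simpler than the corresponding one of ${\rm Tr}$, and simpler in at least one case. For two equivalent modular outer $T$-translations, ${\rm Tr}'$ is a simplification from outside of ${\rm Tr}$ if it is a simplification of ${\rm Tr}$ and $A^{{\rm Tr}'}$ is obtained from $A^{\rm Tr}$ by applying the reductions $\mathcal T^{\rm Tr}_\square(T(A),T(B))\mapsto\mathcal T^{{\rm Tr}'}_\square(T(A),T(B))$ and $\mathcal T^{\rm Tr}_Q(T(A))\mapsto\mathcal T^{{\rm Tr}'}_Q(T(A))$ recursively, starting from the whole formula and working towards the atomic formulas (at each stage the reduction matching the current formula, if there is one, is applied to it, and one then continues with the parts $T(A)$, $T(B)$ that are the translations of the immediate subformulas). -}

module Defs where

open import Algebra.Core using (Op₁)
open import Data.List using (List; []; _∷_; _++_; map)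
open import Data.List.Relation.Binary.Permutation.Propositional using (_↭_)
open import Data.Maybe using (Maybe; just; nothing)
import Data.Maybe as Maybe
open import Data.Nat using (ℕ; zero; suc)
open import Data.Product using (_×_; ∃)
open import Data.Sum using (_⊎_)
open import Data.Vec using (Vec; []; _∷_)
open import Level using (0ℓ)
open import Relation.Binary.Core using (Rel)
open import Relation.Binary.Construct.Union using (_∪_)
open import Relation.Binary.PropositionalEquality using (_≡_; refl)
open import Relation.Nullary using (¬_)

record Signature : Set₁ where
  field
    FunSym   : Set
    funArity : FunSym → ℕ
    RelSym   : Set
    relArity : RelSym → ℕ

open Signature public

variable
  L : Signature

-- De Bruijn variables: under a quantifier, index 0 is the bound variable.
-- Terms are not indexed by a scope, so that, as with named variables,
-- infinitely many free variables are always available.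
data Term (L : Signature) : Set where
  var : ℕ → Term L
  fun : (f : FunSym L) → Vec (Term L) (funArity L f) → Term L

data Atom (L : Signature) : Set where
  rel     : (r : RelSym L) → Vec (Term L) (relArity L r) → Atom L
  𝟏 ⊤ 𝟎 ⊥ : Atom L

data Binary : Set where
  tensor amp plus lolli : Binary

data Unary : Set where
  univ exis bang : Unary

data Formula (L : Signature) : Set where
  atom   : Atom L → Formula L
  binary : Binary → Formula L → Formula L → Formula L
  unary  : Unary → Formula L → Formula L

infixr 30 !_ ∀′_ ∃′_
infixr 25 _⊗_ _&_ _⊕_
infixr 20 _⊸_

pattern _⊗_ A B = binary tensor A B
pattern _&_ A B = binary amp A B
pattern _⊕_ A B = binary plus A B
pattern _⊸_ A B = binary lolli A B
pattern ∀′_ A = unary univ A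
pattern ∃′_ A = unary exis A
pattern !_ A = unary bang A

infixr 30 ∼_ ∼∼_

∼_ : Op₁ (Formula L)
∼ A = A ⊸ atom ⊥

∼∼_ : Op₁ (Formula L)
∼∼ A = ∼ ∼ A

Subst : Signature → Set
Subst L = ℕ → Term L

mutual
  substTerm : Subst L → Term L → Term L
  substTerm σ (var i)    = σ i
  substTerm σ (fun f ts) = fun f (substTerms σ ts)

  substTerms : ∀ {n} → Subst L → Vec (Term L) n → Vec (Term L) n
  substTerms σ []       = []
  substTerms σ (t ∷ ts) = substTerm σ t ∷ substTerms σ ts

shift : Subst L
shift i = var (suc i)

lift : Subst L → Subst L
lift σ zero    = var zero
lift σ (suc i) = substTerm shift (σ i)

substAtom : Subst L → Atom L → Atom L
substAtom σ (rel r ts) = rel r (substTerms σ ts)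
substAtom σ 𝟏          = 𝟏
substAtom σ ⊤          = ⊤
substAtom σ 𝟎          = 𝟎
substAtom σ ⊥          = ⊥

subst : Subst L → Formula L → Formula L
subst σ (atom P)       = atom (substAtom σ P)
subst σ (binary □ A B) = binary □ (subst σ A) (subst σ B)
subst σ (∀′ A)         = ∀′ subst (lift σ) A
subst σ (∃′ A)         = ∃′ subst (lift σ) A
subst σ (! A)          = ! subst σ A

weaken : Formula L → Formula L
weaken = subst shift

instantiate : Term L → Subst L
instantiate t zero    = t
instantiate t (suc i) = var i

_[_] : Formula L → Term L → Formula L
A [ t ] = subst (instantiate t) A

-- A system is ILL⊥ extended by the axioms A ⊢ B for all pairs (A , B) in a
-- given relation; it is identified with that relation.
System : Signature → Set₁
System L = Rel (Formula L) 0ℓ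

infix 4 _∣_⊢_

-- Antecedents are multisets, represented by lists together with `exchange`.
-- A succedent `nothing` is an empty right-hand side.  Weakening the side
-- formulas of ∀R and ∃L by a fresh index 0 is the eigenvariable condition.
data _∣_⊢_ {L : Signature} (S : System L) :
     List (Formula L) → Maybe (Formula L) → Set where
  axiom    : ∀ {A B} → S A B → S ∣ A ∷ [] ⊢ just B
  exchange : ∀ {Γ Δ C} → Γ ↭ Δ → S ∣ Γ ⊢ C → S ∣ Δ ⊢ C

  id  : ∀ {A} → S ∣ A ∷ [] ⊢ just A
  cut : ∀ {Γ Δ A C} → S ∣ Γ ⊢ just A → S ∣ A ∷ Δ ⊢ C → S ∣ Γ ++ Δ ⊢ C

  𝟏R : S ∣ [] ⊢ just (atom 𝟏)
  𝟏L : ∀ {Γ C} → S ∣ Γ ⊢ C → S ∣ atom 𝟏 ∷ Γ ⊢ C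
  ⊤R : ∀ {Γ} → S ∣ Γ ⊢ just (atom ⊤)
  𝟎L : ∀ {Γ C} → S ∣ atom 𝟎 ∷ Γ ⊢ C
  ⊥L : S ∣ atom ⊥ ∷ [] ⊢ nothing
  ⊥R : ∀ {Γ} → S ∣ Γ ⊢ nothing → S ∣ Γ ⊢ just (atom ⊥)

  ⊗R : ∀ {Γ Δ A B} → S ∣ Γ ⊢ just A → S ∣ Δ ⊢ just B →
       S ∣ Γ ++ Δ ⊢ just (A ⊗ B)
  ⊗L : ∀ {Γ A B C} → S ∣ A ∷ B ∷ Γ ⊢ C → S ∣ A ⊗ B ∷ Γ ⊢ C

  ⊸R : ∀ {Γ A B} → S ∣ A ∷ Γ ⊢ just B → S ∣ Γ ⊢ just (A ⊸ B)
  ⊸L : ∀ {Γ Δ A B C} → S ∣ Γ ⊢ just A → S ∣ B ∷ Δ ⊢ C →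
       S ∣ (A ⊸ B) ∷ Γ ++ Δ ⊢ C

  &R  : ∀ {Γ A B} → S ∣ Γ ⊢ just A → S ∣ Γ ⊢ just B → S ∣ Γ ⊢ just (A & B)
  &L₁ : ∀ {Γ A B C} → S ∣ A ∷ Γ ⊢ C → S ∣ A & B ∷ Γ ⊢ C
  &L₂ : ∀ {Γ A B C} → S ∣ B ∷ Γ ⊢ C → S ∣ A & B ∷ Γ ⊢ C

  ⊕R₁ : ∀ {Γ A B} → S ∣ Γ ⊢ just A → S ∣ Γ ⊢ just (A ⊕ B)
  ⊕R₂ : ∀ {Γ A B} → S ∣ Γ ⊢ just B → S ∣ Γ ⊢ just (A ⊕ B)
  ⊕L  : ∀ {Γ A B C} → S ∣ A ∷ Γ ⊢ C → S ∣ B ∷ Γ ⊢ C → S ∣ A ⊕ B ∷ Γ ⊢ C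

  ∀R : ∀ {Γ A} → S ∣ map weaken Γ ⊢ just A → S ∣ Γ ⊢ just (∀′ A)
  ∀L : ∀ {Γ A C} t → S ∣ A [ t ] ∷ Γ ⊢ C → S ∣ ∀′ A ∷ Γ ⊢ C
  ∃R : ∀ {Γ A} t → S ∣ Γ ⊢ just (A [ t ]) → S ∣ Γ ⊢ just (∃′ A)
  ∃L : ∀ {Γ A C} → S ∣ A ∷ map weaken Γ ⊢ Maybe.map weaken C → S ∣ ∃′ A ∷ Γ ⊢ C

  !C : ∀ {Γ A C} → S ∣ ! A ∷ ! A ∷ Γ ⊢ C → S ∣ ! A ∷ Γ ⊢ C
  !W : ∀ {Γ A C} → S ∣ Γ ⊢ C → S ∣ ! A ∷ Γ ⊢ C
  !R : ∀ {Γ A} → S ∣ map !_ Γ ⊢ just A → S ∣ map !_ Γ ⊢ just (! A)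
  !L : ∀ {Γ A C} → S ∣ A ∷ Γ ⊢ C → S ∣ ! A ∷ Γ ⊢ C

data PRO {L : Signature} : System L where
  pro : ∀ {A} → PRO A (! A)

data DNE {L : Signature} : System L where
  dne : ∀ {A} → DNE (∼∼ A) A

IL⊥ : System L
IL⊥ = PRO

CLb : System L
CLb = PRO ∪ DNE

Provable : System L → Formula L → Set
Provable S A = S ∣ [] ⊢ just A

Equivalent : System L → Rel (Formula L) 0ℓ
Equivalent S A B = Provable S ((A ⊸ B) & (B ⊸ A))

_ᴷ : Op₁ (Formula L)
atom P ᴷ         = ∼∼ atom P
(binary □ A B) ᴷ = ∼∼ binary □ (A ᴷ) (B ᴷ)
(unary Q A) ᴷ    = ∼∼ unary Q (A ᴷ)

_ᴳ : Op₁ (Formula L)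
atom P ᴳ  = ∼∼ atom P
(A ⊗ B) ᴳ = (A ᴳ) ⊗ (B ᴳ)
(A & B) ᴳ = (A ᴳ) & (B ᴳ)
(A ⊸ B) ᴳ = (A ᴳ) ⊸ (B ᴳ)
(A ⊕ B) ᴳ = ∼∼ ((A ᴳ) ⊕ (B ᴳ))
(∀′ A) ᴳ  = ∀′ (A ᴳ)
(∃′ A) ᴳ  = ∼∼ ∃′ (A ᴳ)
(! A) ᴳ   = ! (A ᴳ)

-- The choice of T′ ∈ {T , Id} in an outer-transform.
data Outer : Set where
  useT useId : Outer

outer : Op₁ (Formula L) → Outer → Op₁ (Formula L)
outer T useT  A = T A
outer T useId A = A

record ModularOuterTranslation {L : Signature} (T : Op₁ (Formula L)) : Set where
  field
    translate : Op₁ (Formula L)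
    binaryT   : Binary → Outer
    unaryT    : Unary → Outer

  binaryTransform : Binary → Formula L → Formula L → Formula L
  binaryTransform □ A B = outer T (binaryT □) (binary □ A B)

  unaryTransform : Unary → Formula L → Formula L
  unaryTransform Q A = outer T (unaryT Q) (unary Q A)

  field
    translate-atom   : ∀ P → translate (atom P) ≡ T (atom P)
    translate-binary : ∀ □ A B → translate (binary □ A B) ≡
                       binaryTransform □ (translate A) (translate B)
    translate-unary  : ∀ Q A → translate (unary Q A) ≡
                       unaryTransform Q (translate A)

open ModularOuterTranslation public

outerKolmogorov : ModularOuterTranslation {L} ∼∼_
outerKolmogorov = record
  { translate        = _ᴷ
  ; binaryT          = λ _ → useT
  ; unaryT           = λ _ → useT
  ; translate-atom   = λ _ → refl
  ; translate-binary = λ _ _ _ → refl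
  ; translate-unary  = λ _ _ → refl
  }

gödelGentzen : ModularOuterTranslation {L} ∼∼_
gödelGentzen = record
  { translate        = _ᴳ
  ; binaryT          = λ { tensor → useId ; amp → useId ; plus → useT ; lolli → useId }
  ; unaryT           = λ { univ → useId ; exis → useT ; bang → useId }
  ; translate-atom   = λ _ → refl
  ; translate-binary = λ { tensor _ _ → refl ; amp _ _ → refl
                         ; plus _ _ → refl ; lolli _ _ → refl }
  ; translate-unary  = λ { univ _ → refl ; exis _ → refl ; bang _ → refl }
  }

UsesT : Outer → Set
UsesT o = o ≡ useT

Simpler : Outer → Outer → Set
Simpler o′ o = (UsesT o′ → UsesT o) × ¬ (UsesT o → UsesT o′)

Sound : System L → System L → Op₁ (Formula L) → Set
Sound S₁ S₂ tr = ∀ A → (Provable S₁ A → Provable S₂ (tr A)) × Equivalent S₁ A (tr A)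

EquivalentTranslations : System L → System L → Rel (Op₁ (Formula L)) 0ℓ
EquivalentTranslations S₁ S₂ tr tr′ =
  Sound S₁ S₂ tr × Sound S₁ S₂ tr′ × (∀ A → Equivalent S₂ (tr A) (tr′ A))

module _ {L : Signature} (S₁ S₂ : System L) {T : Op₁ (Formula L)} where

  Simplification : Rel (ModularOuterTranslation T) 0ℓ
  Simplification Tr′ Tr =
      EquivalentTranslations S₁ S₂ (translate Tr) (translate Tr′)
    × (∀ □ → binaryT Tr′ □ ≡ binaryT Tr □ ⊎ Simpler (binaryT Tr′ □) (binaryT Tr □))
    × (∀ Q → unaryT Tr′ Q ≡ unaryT Tr Q ⊎ Simpler (unaryT Tr′ Q) (unaryT Tr Q))
    × (∃ (λ □ → Simpler (binaryT Tr′ □) (binaryT Tr □))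
       ⊎ ∃ (λ Q → Simpler (unaryT Tr′ Q) (unaryT Tr Q)))

module _ {L : Signature} where

  -- Apply the reduction matching the current formula, if there is one.
  Stage : Rel (Formula L) 0ℓ → Rel (Formula L) 0ℓ
  Stage _↝_ F F′ = F ↝ F′ ⊎ ((∀ G → ¬ (F ↝ G)) × F ≡ F′)

  -- ReducesTo T tr _↝_ A F: reducing tr A by _↝_ from the outside inwards ends
  -- in F.  After the stage at the whole formula tr A, the process goes on with
  -- the parts that are the translations of the immediate subformulas of A.
  data ReducesTo (T tr : Op₁ (Formula L)) (_↝_ : Rel (Formula L) 0ℓ) :
       Formula L → Formula L → Set where
    atom   : ∀ {P F} → Stage _↝_ (tr (atom P)) F → ReducesTo T tr _↝_ (atom P) F
    binary : ∀ {□ A B A′ B′} (o : Outer) →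
             Stage _↝_ (tr (binary □ A B)) (outer T o (binary □ (tr A) (tr B))) →
             ReducesTo T tr _↝_ A A′ → ReducesTo T tr _↝_ B B′ →
             ReducesTo T tr _↝_ (binary □ A B) (outer T o (binary □ A′ B′))
    unary  : ∀ {Q A A′} (o : Outer) →
             Stage _↝_ (tr (unary Q A)) (outer T o (unary Q (tr A))) →
             ReducesTo T tr _↝_ A A′ →
             ReducesTo T tr _↝_ (unary Q A) (outer T o (unary Q A′))

  data TransformReduction {T : Op₁ (Formula L)} (Tr Tr′ : ModularOuterTranslation T) :
       Rel (Formula L) 0ℓ where
    binary : ∀ □ A B → TransformReduction Tr Tr′
               (binaryTransform Tr □ (T A) (T B)) (binaryTransform Tr′ □ (T A) (T B))
    unary  : ∀ Q A → TransformReduction Tr Tr′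
               (unaryTransform Tr Q (T A)) (unaryTransform Tr′ Q (T A))

SimplificationFromOutside : (S₁ S₂ : System L) {T : Op₁ (Formula L)} →
                            Rel (ModularOuterTranslation T) 0ℓ
SimplificationFromOutside S₁ S₂ {T} Tr′ Tr =
    Simplification S₁ S₂ Tr′ Tr
  × (∀ A → ReducesTo T (translate Tr) (TransformReduction Tr Tr′) A (translate Tr′ A))

infix 4 _↦_

data _↦_ {L : Signature} : Rel (Formula L) 0ℓ where
  &-red : ∀ {A B} → ∼∼ (∼∼ A & ∼∼ B) ↦ ∼∼ A & ∼∼ B
  ⊗-red : ∀ {A B} → ∼∼ (∼∼ A ⊗ ∼∼ B) ↦ ∼∼ A ⊗ ∼∼ B
  ⊸-red : ∀ {A B} → ∼∼ (∼∼ A ⊸ ∼∼ B) ↦ ∼∼ A ⊸ ∼∼ B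
  ∀-red : ∀ {A} → ∼∼ ∀′ ∼∼ A ↦ ∀′ ∼∼ A
  !-red : ∀ {A} → ∼∼ ! ∼∼ A ↦ ! ∼∼ A

-- In the presence of PRO, arbitrary formulas may be weakened and contracted.
-- Since every Aᴷ is a negation, ∼∼ may be introduced in front of any antecedent
-- formula once the succedent is a translation; so each inference of CLb becomes
-- the same inference on the immediate subformulas, followed by an introduction
-- of ∼∼.  Each reduction collapses ∼∼ F to F, where F is built from negations
-- and stable, so Aᴳ and Aᴷ are equivalent by congruence, and soundness of Aᴳ is
-- inherited from that of Aᴷ.
module Submission where

open import Defs
open import Data.List using (List; []; _∷_; map)
open import Data.List.Properties using (map-++; map-∘; map-cong; ++-identityʳ)
open import Data.List.Relation.Binary.Permutation.Propositional
  using (↭-refl; ↭-reflexive; swap)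
open import Data.List.Relation.Binary.Permutation.Propositional.Properties
  using (map⁺; ++-comm)
open import Data.Maybe using (Maybe; just; nothing)
import Data.Maybe as Maybe
open import Data.Nat using (zero; suc)
open import Data.Product using (_×_; _,_; proj₁; proj₂; ∃)
import Data.Product as Product
open import Data.Sum using (inj₁; inj₂)
open import Data.Vec using (Vec; []; _∷_)
open import Function using (_∘_)
open import Relation.Binary.Core using (Rel; _⇒_)
open import Relation.Binary.PropositionalEquality
  using (_≡_; refl; sym; trans; cong; cong₂)
import Relation.Binary.PropositionalEquality as ≡
open import Relation.Nullary using (contradiction)

private
  variable
    S : System L
    A A′ B B′ C : Formula L
    Γ Δ : List (Formula L)
    D : Maybe (Formula L)

-- Substitution

mutual
  substTerm-∘ : (σ τ : Subst L) (t : Term L) →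
                substTerm σ (substTerm τ t) ≡ substTerm (substTerm σ ∘ τ) t
  substTerm-∘ σ τ (var i)    = refl
  substTerm-∘ σ τ (fun f ts) = cong (fun f) (substTerms-∘ σ τ ts)

  substTerms-∘ : (σ τ : Subst L) → ∀ {n} (ts : Vec (Term L) n) →
                 substTerms σ (substTerms τ ts) ≡ substTerms (substTerm σ ∘ τ) ts
  substTerms-∘ σ τ []       = refl
  substTerms-∘ σ τ (t ∷ ts) = cong₂ _∷_ (substTerm-∘ σ τ t) (substTerms-∘ σ τ ts)

LeftInverse : Subst L → Subst L → Set
LeftInverse τ σ = ∀ i → substTerm τ (σ i) ≡ var i

mutual
  substTerm-inverse : {τ σ : Subst L} → LeftInverse τ σ →
                      ∀ t → substTerm τ (substTerm σ t) ≡ t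
  substTerm-inverse inv (var i)    = inv i
  substTerm-inverse inv (fun f ts) = cong (fun f) (substTerms-inverse inv ts)

  substTerms-inverse : {τ σ : Subst L} → LeftInverse τ σ →
                       ∀ {n} (ts : Vec (Term L) n) → substTerms τ (substTerms σ ts) ≡ ts
  substTerms-inverse inv []       = refl
  substTerms-inverse inv (t ∷ ts) =
    cong₂ _∷_ (substTerm-inverse inv t) (substTerms-inverse inv ts)

-- At a successor index, `lift τ` after `shift` is by computation `shift` after `τ`. So `shift` can
-- be pulled outside, where `inv` applies.
lift-inverse : {τ σ : Subst L} → LeftInverse τ σ → LeftInverse (lift τ) (lift σ)
lift-inverse inv zero = refl
lift-inverse {τ = τ} {σ} inv (suc i) =
  trans (substTerm-∘ (lift τ) shift (σ i))
    (trans (sym (substTerm-∘ shift τ (σ i))) (cong (substTerm shift) (inv i)))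

substAtom-inverse : {τ σ : Subst L} → LeftInverse τ σ →
                    ∀ P → substAtom τ (substAtom σ P) ≡ P
substAtom-inverse inv (rel r ts) = cong (rel r) (substTerms-inverse inv ts)
substAtom-inverse inv 𝟏 = refl
substAtom-inverse inv ⊤ = refl
substAtom-inverse inv 𝟎 = refl
substAtom-inverse inv ⊥ = refl

subst-inverse : {τ σ : Subst L} → LeftInverse τ σ → ∀ A → subst τ (subst σ A) ≡ A
subst-inverse inv (atom P)       = cong atom (substAtom-inverse inv P)
subst-inverse inv (binary □ A B) = cong₂ (binary □) (subst-inverse inv A) (subst-inverse inv B)
subst-inverse inv (∀′ A)         = cong ∀′_ (subst-inverse (lift-inverse inv) A)
subst-inverse inv (∃′ A)         = cong ∃′_ (subst-inverse (lift-inverse inv) A)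
subst-inverse inv (! A)          = cong !_ (subst-inverse inv A)

-- weaken (∀′ A) and weaken (∃′ A) have body subst (lift shift) A; instantiating
-- it with the fresh index 0 recovers A.
instantiate-fresh : (A : Formula L) → subst (lift shift) A [ var 0 ] ≡ A
instantiate-fresh = subst-inverse λ { zero → refl ; (suc i) → refl }

-- Carries the instances `A [ t ]` and the weakened side formulas of the quantifier rules through
-- `_ᴷ`.
subst-ᴷ : (σ : Subst L) (A : Formula L) → (subst σ A) ᴷ ≡ subst σ (A ᴷ)
subst-ᴷ σ (atom P)       = refl
subst-ᴷ σ (binary □ A B) = cong₂ (λ A B → ∼∼ binary □ A B) (subst-ᴷ σ A) (subst-ᴷ σ B)
subst-ᴷ σ (∀′ A)         = cong (λ A → ∼∼ ∀′ A) (subst-ᴷ (lift σ) A)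
subst-ᴷ σ (∃′ A)         = cong (λ A → ∼∼ ∃′ A) (subst-ᴷ (lift σ) A)
subst-ᴷ σ (! A)          = cong (λ A → ∼∼ ! A) (subst-ᴷ σ A)

map-weaken-ᴷ : (Γ : List (Formula L)) → map _ᴷ (map weaken Γ) ≡ map weaken (map _ᴷ Γ)
map-weaken-ᴷ Γ = trans (sym (map-∘ Γ)) (trans (map-cong (subst-ᴷ shift) Γ) (map-∘ Γ))

maybe-weaken-ᴷ : (D : Maybe (Formula L)) →
                 Maybe.map _ᴷ (Maybe.map weaken D) ≡ Maybe.map weaken (Maybe.map _ᴷ D)
maybe-weaken-ᴷ (just C) = cong just (subst-ᴷ shift C)
maybe-weaken-ᴷ nothing  = refl

-- Derived sequent rules, valid in every system

≡-antecedent : Γ ≡ Δ → S ∣ Γ ⊢ D → S ∣ Δ ⊢ D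
≡-antecedent eq = exchange (↭-reflexive eq)

exchange₂ : S ∣ A ∷ B ∷ Γ ⊢ D → S ∣ B ∷ A ∷ Γ ⊢ D
exchange₂ = exchange (swap _ _ ↭-refl)

⊸R⁻¹ : S ∣ Γ ⊢ just (A ⊸ B) → S ∣ A ∷ Γ ⊢ just B
⊸R⁻¹ {Γ = Γ} d = exchange (++-comm Γ _) (cut d (⊸L id id))

∼L : S ∣ Γ ⊢ just A → S ∣ ∼ A ∷ Γ ⊢ nothing
∼L {Γ = Γ} d = ≡-antecedent (cong (_ ∷_) (++-identityʳ Γ)) (⊸L d ⊥L)

∼∼R : S ∣ Γ ⊢ just A → S ∣ Γ ⊢ just (∼∼ A)
∼∼R d = ⊸R (⊥R (∼L d))

∼∼L-nothing : S ∣ A ∷ Γ ⊢ nothing → S ∣ ∼∼ A ∷ Γ ⊢ nothing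
∼∼L-nothing d = ∼L (⊸R (⊥R d))

-- Moving `B` to the left leaves `⊥` on the right. Then `A` can be negated twice across the
-- turnstile, and `B` is moved back.
∼∼L-∼ : S ∣ A ∷ Γ ⊢ just (∼ B) → S ∣ ∼∼ A ∷ Γ ⊢ just (∼ B)
∼∼L-∼ d = ⊸R (exchange₂ (⊥R (∼L (⊸R (exchange₂ (⊸R⁻¹ d))))))

∀L-fresh : S ∣ A ∷ Γ ⊢ D → S ∣ weaken (∀′ A) ∷ Γ ⊢ D
∀L-fresh {A = A} d =
  ∀L (var 0) (≡-antecedent (cong (_∷ _) (sym (instantiate-fresh A))) d)

∃R-fresh : S ∣ Γ ⊢ just A → S ∣ Γ ⊢ just (weaken (∃′ A))
∃R-fresh {S = S} {Γ = Γ} {A = A} d =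
  ∃R (var 0) (≡.subst (λ A → S ∣ Γ ⊢ just A) (sym (instantiate-fresh A)) d)

-- Interderivability as a congruence

infix 4 _∣_⊣⊢_

_∣_⊣⊢_ : System L → Rel (Formula L) _
S ∣ A ⊣⊢ B = S ∣ A ∷ [] ⊢ just B × S ∣ B ∷ [] ⊢ just A

⊣⊢-refl : S ∣ A ⊣⊢ A
⊣⊢-refl = id , id

⊣⊢-sym : S ∣ A ⊣⊢ B → S ∣ B ⊣⊢ A
⊣⊢-sym = Product.swap

⊣⊢-trans : S ∣ A ⊣⊢ B → S ∣ B ⊣⊢ C → S ∣ A ⊣⊢ C
⊣⊢-trans (f , f⁻¹) (g , g⁻¹) = cut f g , cut g⁻¹ f⁻¹

⊣⊢⇒Equivalent : S ∣ A ⊣⊢ B → Equivalent S A B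
⊣⊢⇒Equivalent (f , f⁻¹) = &R (⊸R f) (⊸R f⁻¹)

-- `lolli` is contravariant in its first argument and consumes the converse `f⁻¹`. A statement
-- uniform in `□` therefore starts from interderivability.
binary-resp : ∀ □ → S ∣ A ⊣⊢ A′ → S ∣ B ⊣⊢ B′ →
              S ∣ binary □ A B ∷ [] ⊢ just (binary □ A′ B′)
binary-resp tensor (f , _)   (g , _) = ⊗L (⊗R f g)
binary-resp amp    (f , _)   (g , _) = &R (&L₁ f) (&L₂ g)
binary-resp plus   (f , _)   (g , _) = ⊕L (⊕R₁ f) (⊕R₂ g)
binary-resp lolli  (_ , f⁻¹) (g , _) = ⊸R (exchange₂ (⊸L f⁻¹ g))

binary-cong : ∀ □ → S ∣ A ⊣⊢ A′ → S ∣ B ⊣⊢ B′ → S ∣ binary □ A B ⊣⊢ binary □ A′ B′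
binary-cong □ f g = binary-resp □ f g , binary-resp □ (⊣⊢-sym f) (⊣⊢-sym g)

unary-mono : ∀ Q → S ∣ A ∷ [] ⊢ just A′ → S ∣ unary Q A ∷ [] ⊢ just (unary Q A′)
unary-mono univ f = ∀R (∀L-fresh f)
unary-mono exis f = ∃L (∃R-fresh f)
unary-mono bang f = !R (!L f)

unary-cong : ∀ Q → S ∣ A ⊣⊢ A′ → S ∣ unary Q A ⊣⊢ unary Q A′
unary-cong Q (f , f⁻¹) = unary-mono Q f , unary-mono Q f⁻¹

∼∼-cong : S ∣ A ⊣⊢ B → S ∣ ∼∼ A ⊣⊢ ∼∼ B
∼∼-cong f = binary-cong lolli (binary-cong lolli f ⊣⊢-refl) ⊣⊢-refl

-- The image of ᴷ

-- Matching on this equation under `with` turns `A ᴷ` into a literal double negation, so that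
-- `∼∼L-∼` and the constructors of `_↦_` apply.
ᴷ-∼∼ : (A : Formula L) → ∃ λ B → A ᴷ ≡ ∼∼ B
ᴷ-∼∼ (atom P)       = _ , refl
ᴷ-∼∼ (binary □ A B) = _ , refl
ᴷ-∼∼ (unary Q A)    = _ , refl

∼∼L-ᴷ : ∀ D → S ∣ A ∷ Γ ⊢ Maybe.map _ᴷ D → S ∣ ∼∼ A ∷ Γ ⊢ Maybe.map _ᴷ D
∼∼L-ᴷ nothing d = ∼∼L-nothing d
∼∼L-ᴷ (just C) d with C ᴷ | ᴷ-∼∼ C
... | _ | _ , refl = ∼∼L-∼ d

&-redᴷ : (A B : Formula L) → (A & B) ᴷ ↦ (A ᴷ) & (B ᴷ)
&-redᴷ A B with A ᴷ | ᴷ-∼∼ A | B ᴷ | ᴷ-∼∼ B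
... | _ | _ , refl | _ | _ , refl = &-red

⊗-redᴷ : (A B : Formula L) → (A ⊗ B) ᴷ ↦ (A ᴷ) ⊗ (B ᴷ)
⊗-redᴷ A B with A ᴷ | ᴷ-∼∼ A | B ᴷ | ᴷ-∼∼ B
... | _ | _ , refl | _ | _ , refl = ⊗-red

⊸-redᴷ : (A B : Formula L) → (A ⊸ B) ᴷ ↦ (A ᴷ) ⊸ (B ᴷ)
⊸-redᴷ A B with A ᴷ | ᴷ-∼∼ A | B ᴷ | ᴷ-∼∼ B
... | _ | _ , refl | _ | _ , refl = ⊸-red

∀-redᴷ : (A : Formula L) → (∀′ A) ᴷ ↦ ∀′ (A ᴷ)
∀-redᴷ A with A ᴷ | ᴷ-∼∼ A
... | _ | _ , refl = ∀-red

!-redᴷ : (A : Formula L) → (! A) ᴷ ↦ ! (A ᴷ)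
!-redᴷ A with A ᴷ | ᴷ-∼∼ A
... | _ | _ , refl = !-red

-- Systems with PRO

module _ {L : Signature} {S : System L} (PRO⇒S : PRO ⇒ S) where

  promote : S ∣ Γ ⊢ just A → S ∣ Γ ⊢ just (! A)
  promote {Γ = Γ} d = ≡-antecedent (++-identityʳ Γ) (cut d (axiom (PRO⇒S pro)))

  -- A cut with `A ⊢ ! A` makes the structural rules for `!` available to `A`; contraction works
  -- likewise.
  weakening : S ∣ Γ ⊢ D → S ∣ A ∷ Γ ⊢ D
  weakening d = cut (promote id) (!W d)

  contraction : S ∣ A ∷ A ∷ Γ ⊢ D → S ∣ A ∷ Γ ⊢ D
  contraction d = cut (promote id) (!C (!L (exchange₂ (!L d))))

  -- From left to right, the reduct is decomposed on the right until the succedent is a negation;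
  -- `∼∼L-∼` then opens the outer `∼∼` on the left.
  ↦⇒⊣⊢ : ∀ {F F′} → F ↦ F′ → S ∣ F ⊣⊢ F′
  ↦⇒⊣⊢ r = reduct r , ∼∼-expansion r
    where
    reduct : ∀ {F F′} → F ↦ F′ → S ∣ F ∷ [] ⊢ just F′
    reduct &-red = &R (∼∼L-∼ (&L₁ id)) (∼∼L-∼ (&L₂ id))
    -- `⊗R` splits the context, so the hypothesis is duplicated. Each copy yields one factor and
    -- discards the other.
    reduct ⊗-red = contraction (⊗R (∼∼L-∼ (⊗L (exchange₂ (weakening id))))
                                   (∼∼L-∼ (⊗L (weakening id))))
    reduct ⊸-red = ⊸R (exchange₂ (∼∼L-∼ (⊸L id id)))
    reduct ∀-red = ∀R (∼∼L-∼ (∀L-fresh id))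
    -- The context is not of the form `!Γ`, so `!R` is replaced by `promote`.
    reduct !-red = promote (∼∼L-∼ (!L id))

    ∼∼-expansion : ∀ {F F′} → F ↦ F′ → S ∣ F′ ∷ [] ⊢ just F
    -- Only the case split reveals that `F` is `∼∼ F′`.
    ∼∼-expansion &-red = ∼∼R id
    ∼∼-expansion ⊗-red = ∼∼R id
    ∼∼-expansion ⊸-red = ∼∼R id
    ∼∼-expansion ∀-red = ∼∼R id
    ∼∼-expansion !-red = ∼∼R id

  -- General in `S`, since it serves `IL⊥` for the equivalence of the translations and `CLb` for the
  -- soundness of `_ᴳ`.
  ᴷ⊣⊢ᴳ : ∀ A → S ∣ A ᴷ ⊣⊢ A ᴳ
  ᴷ⊣⊢ᴳ (atom P) = ⊣⊢-refl
  ᴷ⊣⊢ᴳ (A ⊗ B)  = ⊣⊢-trans (↦⇒⊣⊢ (⊗-redᴷ A B)) (binary-cong tensor (ᴷ⊣⊢ᴳ A) (ᴷ⊣⊢ᴳ B))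
  ᴷ⊣⊢ᴳ (A & B)  = ⊣⊢-trans (↦⇒⊣⊢ (&-redᴷ A B)) (binary-cong amp (ᴷ⊣⊢ᴳ A) (ᴷ⊣⊢ᴳ B))
  ᴷ⊣⊢ᴳ (A ⊕ B)  = ∼∼-cong (binary-cong plus (ᴷ⊣⊢ᴳ A) (ᴷ⊣⊢ᴳ B))
  ᴷ⊣⊢ᴳ (A ⊸ B)  = ⊣⊢-trans (↦⇒⊣⊢ (⊸-redᴷ A B)) (binary-cong lolli (ᴷ⊣⊢ᴳ A) (ᴷ⊣⊢ᴳ B))
  ᴷ⊣⊢ᴳ (∀′ A)   = ⊣⊢-trans (↦⇒⊣⊢ (∀-redᴷ A)) (unary-cong univ (ᴷ⊣⊢ᴳ A))
  ᴷ⊣⊢ᴳ (∃′ A)   = ∼∼-cong (unary-cong exis (ᴷ⊣⊢ᴳ A))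
  ᴷ⊣⊢ᴳ (! A)    = ⊣⊢-trans (↦⇒⊣⊢ (!-redᴷ A)) (unary-cong bang (ᴷ⊣⊢ᴳ A))

  -- Once the outermost `∼∼` is opened, write `A ᴷ` as `∼∼ B`. Assuming `∼ B` gives `(∼ A) ᴷ`, the
  -- remaining hypothesis turns this into `∼∼ atom ⊥`, and `⊥` follows.
  dneᴷ : ∀ A → S ∣ (∼∼ A) ᴷ ∷ [] ⊢ just (A ᴷ)
  dneᴷ A = ∼∼L-ᴷ (just A) (stable A)
    where
    stable : ∀ A → S ∣ ((∼ A) ᴷ) ⊸ ∼∼ atom ⊥ ∷ [] ⊢ just (A ᴷ)
    stable A with A ᴷ | ᴷ-∼∼ A
    ... | _ | _ , refl =
      ⊸R (exchange₂ (⊸L (∼∼R (⊸R (∼∼R (⊸L id id)))) (⊥R (∼∼L-nothing ⊥L))))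

  -- Induction on derivations needs whole sequents, including those with empty succedent.
  ᴷ-sound : CLb ∣ Γ ⊢ D → S ∣ map _ᴷ Γ ⊢ Maybe.map _ᴷ D
  ᴷ-sound (axiom (inj₁ pro)) = ∼∼R (promote id)
  ᴷ-sound (axiom (inj₂ (dne {A}))) = dneᴷ A
  ᴷ-sound (exchange p d) = exchange (map⁺ _ᴷ p) (ᴷ-sound d)
  ᴷ-sound id = id
  ᴷ-sound (cut {Γ} {Δ} d e) =
    ≡-antecedent (sym (map-++ _ᴷ Γ Δ)) (cut (ᴷ-sound d) (ᴷ-sound e))
  ᴷ-sound 𝟏R = ∼∼R 𝟏R
  ᴷ-sound (𝟏L d) = weakening (ᴷ-sound d)
  ᴷ-sound ⊤R = ∼∼R ⊤R
  ᴷ-sound (𝟎L {C = D}) = ∼∼L-ᴷ D 𝟎L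
  ᴷ-sound ⊥L = ∼∼L-nothing ⊥L
  ᴷ-sound (⊥R d) = ∼∼R (⊥R (ᴷ-sound d))
  ᴷ-sound (⊗R {Γ} {Δ} d e) =
    ≡-antecedent (sym (map-++ _ᴷ Γ Δ)) (∼∼R (⊗R (ᴷ-sound d) (ᴷ-sound e)))
  ᴷ-sound (⊗L {C = D} d) = ∼∼L-ᴷ D (⊗L (ᴷ-sound d))
  ᴷ-sound (⊸R d) = ∼∼R (⊸R (ᴷ-sound d))
  ᴷ-sound (⊸L {Γ} {Δ} {C = D} d e) =
    ≡-antecedent (cong (_ ∷_) (sym (map-++ _ᴷ Γ Δ)))
      (∼∼L-ᴷ D (⊸L (ᴷ-sound d) (ᴷ-sound e)))
  ᴷ-sound (&R d e) = ∼∼R (&R (ᴷ-sound d) (ᴷ-sound e))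
  ᴷ-sound (&L₁ {C = D} d) = ∼∼L-ᴷ D (&L₁ (ᴷ-sound d))
  ᴷ-sound (&L₂ {C = D} d) = ∼∼L-ᴷ D (&L₂ (ᴷ-sound d))
  ᴷ-sound (⊕R₁ d) = ∼∼R (⊕R₁ (ᴷ-sound d))
  ᴷ-sound (⊕R₂ d) = ∼∼R (⊕R₂ (ᴷ-sound d))
  ᴷ-sound (⊕L {C = D} d e) = ∼∼L-ᴷ D (⊕L (ᴷ-sound d) (ᴷ-sound e))
  ᴷ-sound (∀R {Γ} d) = ∼∼R (∀R (≡-antecedent (map-weaken-ᴷ Γ) (ᴷ-sound d)))
  ᴷ-sound (∀L {A = A} {D} t d) =
    ∼∼L-ᴷ D (∀L t (≡-antecedent (cong (_∷ _) (subst-ᴷ (instantiate t) A)) (ᴷ-sound d)))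
  ᴷ-sound (∃R {Γ} {A} t d) =
    ∼∼R (∃R t (≡.subst (λ A → S ∣ map _ᴷ Γ ⊢ just A) (subst-ᴷ (instantiate t) A) (ᴷ-sound d)))
  ᴷ-sound (∃L {Γ} {A} {D} d) =
    ∼∼L-ᴷ D (∃L (≡.subst (S ∣ A ᴷ ∷ map weaken (map _ᴷ Γ) ⊢_) (maybe-weaken-ᴷ D)
      (≡-antecedent (cong (A ᴷ ∷_) (map-weaken-ᴷ Γ)) (ᴷ-sound d))))
  -- The image of `! A` begins with `∼∼`, so in these three cases the rules for arbitrary formulas
  -- replace those for `!`.
  ᴷ-sound (!C d) = contraction (ᴷ-sound d)
  ᴷ-sound (!W d) = weakening (ᴷ-sound d)
  ᴷ-sound (!R d) = ∼∼R (promote (ᴷ-sound d))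
  ᴷ-sound (!L {C = D} d) = ∼∼L-ᴷ D (!L (ᴷ-sound d))

-- Soundness of both translations

CLb-⊣⊢∼∼ : CLb ∣ A ⊣⊢ ∼∼ A
CLb-⊣⊢∼∼ = ∼∼R id , axiom (inj₂ dne)

CLb-⊣⊢ᴷ : (A : Formula L) → CLb ∣ A ⊣⊢ A ᴷ
CLb-⊣⊢ᴷ (atom P)       = CLb-⊣⊢∼∼
CLb-⊣⊢ᴷ (binary □ A B) = ⊣⊢-trans (binary-cong □ (CLb-⊣⊢ᴷ A) (CLb-⊣⊢ᴷ B)) CLb-⊣⊢∼∼
CLb-⊣⊢ᴷ (unary Q A)    = ⊣⊢-trans (unary-cong Q (CLb-⊣⊢ᴷ A)) CLb-⊣⊢∼∼

IL⊥-ᴷ⊣⊢ᴳ : (A : Formula L) → IL⊥ ∣ A ᴷ ⊣⊢ A ᴳ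
IL⊥-ᴷ⊣⊢ᴳ = ᴷ⊣⊢ᴳ (λ r → r)

Sound-ᴷ : Sound {L} CLb IL⊥ _ᴷ
Sound-ᴷ A = ᴷ-sound (λ r → r) , ⊣⊢⇒Equivalent (CLb-⊣⊢ᴷ A)

Sound-ᴳ : Sound {L} CLb IL⊥ _ᴳ
Sound-ᴳ A = (λ d → cut (proj₁ (Sound-ᴷ A) d) (proj₁ (IL⊥-ᴷ⊣⊢ᴳ A)))
          , ⊣⊢⇒Equivalent (⊣⊢-trans (CLb-⊣⊢ᴷ A) (ᴷ⊣⊢ᴳ inj₁ A))

-- Reduction from outside

module _ {T : Formula L → Formula L} (Tr Tr′ : ModularOuterTranslation T)
         {_↝_ : Rel (Formula L) _}
         (atomStage   : ∀ P → Stage _↝_ (translate Tr (atom P)) (T (atom P)))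
         (binaryStage : ∀ □ A B → Stage _↝_ (translate Tr (binary □ A B))
                          (binaryTransform Tr′ □ (translate Tr A) (translate Tr B)))
         (unaryStage  : ∀ Q A → Stage _↝_ (translate Tr (unary Q A))
                          (unaryTransform Tr′ Q (translate Tr A)))
         where

  -- After the stage at the whole formula, its immediate parts are still `Tr`-translations, so the
  -- stages can be checked independently of each other.
  reducesTo : ∀ A → ReducesTo T (translate Tr) _↝_ A (translate Tr′ A)
  reducesTo (atom P) rewrite translate-atom Tr′ P = atom (atomStage P)
  reducesTo (binary □ A B) rewrite translate-binary Tr′ □ A B =
    binary (binaryT Tr′ □) (binaryStage □ A B) (reducesTo A) (reducesTo B)
  reducesTo (unary Q A) rewrite translate-unary Tr′ Q A =
    unary (unaryT Tr′ Q) (unaryStage Q A) (reducesTo A)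

reducesTo-↦ : (A : Formula L) → ReducesTo ∼∼_ _ᴷ _↦_ A (A ᴳ)
reducesTo-↦ = reducesTo outerKolmogorov gödelGentzen
  -- No left-hand side of `_↦_` is a doubly negated atom; likewise for `plus` and `exis` below.
  (λ _ → inj₂ ((λ _ ()) , refl))
  (λ { tensor A B → inj₁ (⊗-redᴷ A B)
     ; amp    A B → inj₁ (&-redᴷ A B)
     ; plus   A B → inj₂ ((λ _ ()) , refl)
     ; lolli  A B → inj₁ (⊸-redᴷ A B) })
  (λ { univ A → inj₁ (∀-redᴷ A)
     ; exis A → inj₂ ((λ _ ()) , refl)
     ; bang A → inj₁ (!-redᴷ A) })

reducesTo-transforms : (A : Formula L) →
  ReducesTo ∼∼_ _ᴷ (TransformReduction outerKolmogorov gödelGentzen) A (A ᴳ)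
reducesTo-transforms = reducesTo outerKolmogorov gödelGentzen
  (λ _ → inj₂ ((λ { _ () }) , refl)) binaryStage unaryStage
  where
  binaryStage : ∀ □ (A B : Formula L) →
    Stage (TransformReduction outerKolmogorov gödelGentzen)
          ((binary □ A B) ᴷ) (binaryTransform gödelGentzen □ (A ᴷ) (B ᴷ))
  binaryStage □ A B with A ᴷ | ᴷ-∼∼ A | B ᴷ | ᴷ-∼∼ B
  -- For `plus` the two transforms coincide and the reduction is an identity step, so every
  -- connective reduces here, unlike under `_↦_`.
  ... | _ | _ , refl | _ | _ , refl = inj₁ (binary □ _ _)

  unaryStage : ∀ Q (A : Formula L) →
    Stage (TransformReduction outerKolmogorov gödelGentzen)
          ((unary Q A) ᴷ) (unaryTransform gödelGentzen Q (A ᴷ))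
  unaryStage Q A with A ᴷ | ᴷ-∼∼ A
  ... | _ | _ , refl = inj₁ (unary Q _)

-- Comparison of the transforms

useId-simpler : Simpler useId useT
useId-simpler = (λ ()) , λ f → contradiction (f refl) λ ()

simplification : Simplification {L} CLb IL⊥ gödelGentzen outerKolmogorov
simplification =
    (Sound-ᴷ , Sound-ᴳ , λ A → ⊣⊢⇒Equivalent (IL⊥-ᴷ⊣⊢ᴳ A))
  , (λ { tensor → inj₂ useId-simpler
       ; amp    → inj₂ useId-simpler
       ; plus   → inj₁ refl
       ; lolli  → inj₂ useId-simpler })
  , (λ { univ → inj₂ useId-simpler
       ; exis → inj₁ refl
       ; bang → inj₂ useId-simpler })
  -- Any construct for which `_ᴳ` drops `∼∼` could serve as the witness.
  , inj₁ (tensor , useId-simpler)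

proposition7 : (L : Signature) →
    ((A : Formula L) → ReducesTo ∼∼_ _ᴷ _↦_ A (A ᴳ))
    × SimplificationFromOutside {L} CLb IL⊥ gödelGentzen outerKolmogorov
    × ((F F′ : Formula L) → F ↦ F′ → Equivalent IL⊥ F F′)
    × ((A : Formula L) → Equivalent IL⊥ (A ᴳ) (A ᴷ))
proposition7 L =
    reducesTo-↦
  , (simplification , reducesTo-transforms)
  , (λ _ _ r → ⊣⊢⇒Equivalent (↦⇒⊣⊢ (λ r → r) r))
  , (λ A → ⊣⊢⇒Equivalent (⊣⊢-sym (IL⊥-ᴷ⊣⊢ᴳ A)))
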